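{- Let $n\ge 1$. For $\pi\in\mathcal S_n(321)$ let $\mathrm{fp}(\pi)=|\{i:\pi(i)=i\}|$ be the number of fixed points of $\pi$. Then the statistic $\mathrm{fp}$ is $1$-mesic under the action of rowmotion $\rho_{\mathcal S}$ on $\mathcal S_n(321)$; that is, for every orbit $\mathcal O$ of $\rho_{\mathcal S}$ on $\mathcal S_n(321)$, $\frac{1}{|\mathcal O|}\sum_{\pi\in\mathcal O}\mathrm{fp}(\pi)=1$.
   Context: $\mathcal S_n(321)$ is the set of permutations $\pi$ of $\{1,\dots,n\}$ that are $321$-avoiding: there are no $i<j<k$ with $\pi(i)>\pi(j)>\pi(k)$. $\mathbf A^{n-1}$ is the poset of intervals $\{[i,j]:1\le i\le j\le n-1\}$ ordered by inclusion (type $A$ positive root poset), and $\mathcal A(\mathbf A^{n-1})$ is its set of antichains. Antichain rowmotion $\rho_{\mathcal A}:\mathcal A(\mathbf A^{n-1})\to\mathcal A(\mathbf A^{n-1})$ sends an antichain $A$ to the set of minimal elements of the complement of the order ideal $\{x: x\le y\text{ for some }y\in A\}$ generated by $A$; it is a bijection. The map $\mathrm{Exc}:\mathcal S_n(321)\to\mathcal A(\mathbf A^{n-1})$, $\mathrm{Exc}(\pi)=\{[i,\pi(i)-1]:\pi(i)>i\}$, is a bijection. Rowmotion on $321$-avoiding permutations is $\rho_{\mathcal S}=\mathrm{Exc}^{ -1}\circ\rho_{\mathcal A}\circ\mathrm{Exc}$. -}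

module Defs where

open import Data.Empty using (⊥-elim)
open import Data.Fin.Base as Fin using (Fin; zero; suc; toℕ; fromℕ<; punchIn; punchOut)
open import Data.Fin.Permutation as Perm
  using (Permutation′; _⟨$⟩ʳ_; _⟨$⟩ˡ_; inverseˡ; inverseʳ; flip; insert; _∘ₚ_)
open import Data.Fin.Properties as Finₚ
  using (any?; toℕ<n; toℕ-injective; toℕ-fromℕ<; injective⇒≤)
open import Data.Integer.Base using (+_)
open import Data.List.Base using (List; allFin; filter; length; map)
open import Data.List.NonEmpty using (List⁺; _∷_; toList)
open import Data.List.Membership.Setoid using (_∈_)
open import Data.List.Relation.Unary.Unique.Setoid using (Unique)
open import Data.Nat.Base using (ℕ; zero; suc; _+_; _≤_; _<_; z≤n; s≤s; s≤s⁻¹)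
open import Data.Nat.ListAction using (sum)
open import Data.Nat.GeneralisedArithmetic using (iterate)
open import Data.Nat.Properties
open import Data.Product.Base using (Σ; ∃; ∃-syntax; _×_; _,_; proj₁; proj₂)
open import Data.Rational.Base using (ℚ; _/_)
open import Data.Sum.Base using (_⊎_; inj₁; inj₂)
open import Function.Base using (_∘_)
open import Function.Bundles using (Bijection; _⇔_)
open import Level as Level using (Level; 0ℓ; _⊔_)
open import Relation.Binary.Bundles using (Setoid)
open import Relation.Binary.Definitions using (tri<; tri≈; tri>)
open import Relation.Binary.PropositionalEquality
  using (_≡_; _≢_; refl; sym; trans; cong; subst)
open import Relation.Nullary using (¬_; Dec; yes; no)
open import Relation.Nullary.Decidable using (_×-dec_; map′; ¬?; decidable-stable)
open import Relation.Unary using (Pred; Decidable; _≐_)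

private variable
  a ℓ : Level
  n : ℕ

------------------------------------------------------------------------
-- Intervals of {1,…,n-1}

record Interval (n : ℕ) : Set where
  constructor [_,_∣_,_,_]
  field
    lo hi : ℕ
    1≤lo  : 1 ≤ lo
    lo≤hi : lo ≤ hi
    hi<n  : hi < n

open Interval public

infix 4 _⊑_

_⊑_ : Interval n → Interval n → Set
x ⊑ y = lo y ≤ lo x × hi x ≤ hi y

Interval-≡ : {x y : Interval n} → lo x ≡ lo y → hi x ≡ hi y → x ≡ y
Interval-≡ {x = [ _ , _ ∣ p , q , r ]} {[ _ , _ ∣ p′ , q′ , r′ ]} refl refl
  with refl ← ≤-irrelevant p p′ | refl ← ≤-irrelevant q q′ | refl ← ≤-irrelevant r r′ = refl

⊑-antisym : {x y : Interval n} → x ⊑ y → y ⊑ x → x ≡ y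
⊑-antisym (a , b) (c , d) = Interval-≡ (≤-antisym c a) (≤-antisym b d)

_⊑?_ : (x y : Interval n) → Dec (x ⊑ y)
x ⊑? y = (lo y ≤? lo x) ×-dec (hi x ≤? hi y)

_≟ᴵ_ : (x y : Interval n) → Dec (x ≡ y)
x ≟ᴵ y = map′ (λ (p , q) → Interval-≡ p q) (λ { refl → refl , refl })
              ((lo x ≟ lo y) ×-dec (hi x ≟ hi y))

anyInterval? : {P : Pred (Interval n) 0ℓ} → Decidable P → Dec (∃ P)
anyInterval? {n} {P} P? =
  map′ (λ (_ , _ , _ , p , q , r , z) → _ , z)
       (λ { ([ l , h ∣ p , q , r ] , z) → h , r , l , p , q , r , z })
       (anyUpTo? anyLo? n)
  where
  Good : ℕ → ℕ → Set
  Good h l = ∃[ p ] ∃[ q ] ∃[ r ] P [ l , h ∣ p , q , r ]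

  good? : ∀ h l → Dec (Good h l)
  good? h l with 1 ≤? l | l ≤? h | h <? n
  ... | no ¬p | _ | _ = no λ (p , _) → ¬p p
  ... | yes _ | no ¬q | _ = no λ (_ , q , _) → ¬q q
  ... | yes _ | yes _ | no ¬r = no λ (_ , _ , r , _) → ¬r r
  ... | yes p | yes q | yes r with P? [ l , h ∣ p , q , r ]
  ...   | yes z = yes (p , q , r , z)
  ...   | no ¬z = no λ (_ , _ , _ , z) → ¬z (subst P (Interval-≡ refl refl) z)

  anyLo? : ∀ h → Dec (∃ (Good h))
  anyLo? h = map′ (λ (l , _ , g) → l , g)
                  (λ { (l , g@(_ , q , _)) → l , s≤s q , g })
                  (anyUpTo? (good? h) (suc h))

------------------------------------------------------------------------
-- Antichains and antichain rowmotion

-- A (finite) set of intervals is a decidable predicate; two antichains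
-- are equal when they have the same elements.
record Antichain (n : ℕ) : Set₁ where
  field
    elems     : Pred (Interval n) 0ℓ
    elems?    : Decidable elems
    antichain : ∀ {x y} → elems x → elems y → x ⊑ y → x ≡ y

open Antichain public

Antichain-setoid : ℕ → Setoid (Level.suc 0ℓ) 0ℓ
Antichain-setoid n = record
  { Carrier       = Antichain n
  ; _≈_           = λ A B → elems A ≐ elems B
  ; isEquivalence = record
    { refl  = (λ z → z) , (λ z → z)
    ; sym   = λ (f , g) → g , f
    ; trans = λ (f , g) (f′ , g′) → f′ ∘ f , g ∘ g′
    }
  }

↓ : Pred (Interval n) 0ℓ → Pred (Interval n) 0ℓ
↓ P x = ∃ λ y → P y × x ⊑ y

Minimal : Pred (Interval n) 0ℓ → Pred (Interval n) 0ℓ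
Minimal P x = P x × (∀ y → P y → y ⊑ x → y ≡ x)

Minimal? : {P : Pred (Interval n) 0ℓ} → Decidable P → Decidable (Minimal P)
Minimal? {P = P} P? x = P? x ×-dec
  map′ (λ none y Py y⊑x → decidable-stable (y ≟ᴵ x) λ y≢x → none (y , Py , y⊑x , y≢x))
       (λ min (y , Py , y⊑x , y≢x) → y≢x (min y Py y⊑x))
       (¬? (anyInterval? λ y → P? y ×-dec (y ⊑? x) ×-dec ¬? (y ≟ᴵ x)))

ρ𝒜 : Antichain n → Antichain n
ρ𝒜 A = record
  { elems     = Minimal (λ x → ¬ ↓ (elems A) x)
  ; elems?    = Minimal? λ x → ¬? (anyInterval? λ y → elems? A y ×-dec (x ⊑? y))
  ; antichain = λ {x} (x∉ , _) (_ , min) x⊑y → min x x∉ x⊑y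
  }

------------------------------------------------------------------------
-- 321-avoiding permutations

Avoids321 : Permutation′ n → Set
Avoids321 {n} π = ∀ (i j k : Fin n) → i Fin.< j → j Fin.< k →
  ¬ (π ⟨$⟩ʳ j Fin.< π ⟨$⟩ʳ i × π ⟨$⟩ʳ k Fin.< π ⟨$⟩ʳ j)

record S₃₂₁ (n : ℕ) : Set where
  constructor _avoiding_
  field
    perm   : Permutation′ n
    avoids : Avoids321 perm

open S₃₂₁ public

S₃₂₁-setoid : ℕ → Setoid 0ℓ 0ℓ
S₃₂₁-setoid n = record
  { Carrier       = S₃₂₁ n
  ; _≈_           = λ π σ → perm π Perm.≈ perm σ
  ; isEquivalence = record
    { refl  = λ _ → refl
    ; sym   = λ e i → sym (e i)
    ; trans = λ e f i → trans (e i) (f i)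
    }
  }

fp : S₃₂₁ n → ℕ
fp {n} π = length (filter (λ i → perm π ⟨$⟩ʳ i Finₚ.≟ i) (allFin n))

perm-injective : (π : Permutation′ n) {i j : Fin n} → π ⟨$⟩ʳ i ≡ π ⟨$⟩ʳ j → i ≡ j
perm-injective π {i} {j} e = trans (sym (inverseˡ π)) (trans (cong (π ⟨$⟩ˡ_) e) (inverseˡ π))

-- Pigeonhole: if the value π(b) < π(a) ≤ a is taken to the right of a,
-- some position left of a takes a value exceeding π(a).
larger-before : (π : Permutation′ n) (a b : Fin n) → a Fin.< b →
  π ⟨$⟩ʳ b Fin.< π ⟨$⟩ʳ a → π ⟨$⟩ʳ a Fin.≤ a →
  ∃ λ c → c Fin.< a × π ⟨$⟩ʳ a Fin.< π ⟨$⟩ʳ c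
larger-before {n} π a b a<b πb<πa πa≤a
  with any? (λ c → (c Finₚ.<? a) ×-dec (π ⟨$⟩ʳ a Finₚ.<? π ⟨$⟩ʳ c))
... | yes found = found
... | no none = ⊥-elim (<-irrefl refl (≤-trans (injective⇒≤ f-injective) πa≤a))
  where
  pos : Fin (suc (toℕ a)) → Fin n
  pos zero    = b
  pos (suc c) = Fin.inject≤ c (<⇒≤ (toℕ<n a))

  pos<a : ∀ c → pos (suc c) Fin.< a
  pos<a c = subst (_< toℕ a) (sym (Finₚ.toℕ-inject≤ c _)) (toℕ<n c)

  small : ∀ c → π ⟨$⟩ʳ pos c Fin.< π ⟨$⟩ʳ a
  small zero    = πb<πa
  small (suc c) with Finₚ.<-cmp (π ⟨$⟩ʳ pos (suc c)) (π ⟨$⟩ʳ a)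
  ... | tri< lt _ _ = lt
  ... | tri≈ _ eq _ = ⊥-elim (<-irrefl (cong toℕ (perm-injective π eq)) (pos<a c))
  ... | tri> _ _ gt = ⊥-elim (none (_ , pos<a c , gt))

  pos-injective : ∀ {c d} → pos c ≡ pos d → c ≡ d
  pos-injective {zero}  {zero}  _ = refl
  pos-injective {zero}  {suc d} e = ⊥-elim (<-asym a<b (subst (Fin._< a) (sym e) (pos<a d)))
  pos-injective {suc c} {zero}  e = ⊥-elim (<-asym a<b (subst (Fin._< a) e (pos<a c)))
  pos-injective {suc c} {suc d} e = cong suc (Finₚ.inject≤-injective _ _ c d e)

  f : Fin (suc (toℕ a)) → Fin (toℕ (π ⟨$⟩ʳ a))
  f c = fromℕ< (small c)

  f-injective : ∀ {c d} → f c ≡ f d → c ≡ d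
  f-injective {c} {d} e = pos-injective (perm-injective π (toℕ-injective
    (Finₚ.fromℕ<-injective _ _ (small c) (small d) e)))

------------------------------------------------------------------------
-- Exc

-- Fin n is 0-based, so p : Fin n stands for i = suc (toℕ p), and
-- π(i) - 1 is toℕ (π ⟨$⟩ʳ p).
ExcSet : Permutation′ n → Pred (Interval n) 0ℓ
ExcSet π x = ∃ λ p → p Fin.< π ⟨$⟩ʳ p × lo x ≡ suc (toℕ p) × hi x ≡ toℕ (π ⟨$⟩ʳ p)

excedances-increase : (π : S₃₂₁ n) {p q : Fin n} →
  q Fin.< p → p Fin.< perm π ⟨$⟩ʳ p → perm π ⟨$⟩ʳ q Fin.< perm π ⟨$⟩ʳ p
excedances-increase (π avoiding av) {p} {q} q<p p<πp
  with Finₚ.<-cmp (π ⟨$⟩ʳ q) (π ⟨$⟩ʳ p)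
... | tri< lt _ _ = lt
... | tri≈ _ eq _ = ⊥-elim (<-irrefl (cong toℕ (perm-injective π eq)) q<p)
... | tri> _ _ gt
  with c , c<πp , p<τc ← larger-before (flip π) (π ⟨$⟩ʳ p) (π ⟨$⟩ʳ q) gt
         (subst (λ z → π ⟨$⟩ˡ (π ⟨$⟩ʳ q) Fin.< z) (sym (inverseˡ π))
           (subst (Fin._< p) (sym (inverseˡ π)) q<p))
         (subst (Fin._≤ π ⟨$⟩ʳ p) (sym (inverseˡ π)) (<⇒≤ p<πp))
  = ⊥-elim (av q p (π ⟨$⟩ˡ c) q<p (subst (Fin._< π ⟨$⟩ˡ c) (inverseˡ π) p<τc)
      (gt , subst (Fin._< π ⟨$⟩ʳ p) (sym (inverseʳ π)) c<πp))

nonexcedances-increase : (π : S₃₂₁ n) {p q : Fin n} →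
  p Fin.< q → perm π ⟨$⟩ʳ p Fin.≤ p → perm π ⟨$⟩ʳ p Fin.< perm π ⟨$⟩ʳ q
nonexcedances-increase (π avoiding av) {p} {q} p<q πp≤p
  with Finₚ.<-cmp (π ⟨$⟩ʳ p) (π ⟨$⟩ʳ q)
... | tri< lt _ _ = lt
... | tri≈ _ eq _ = ⊥-elim (<-irrefl (cong toℕ (perm-injective π eq)) p<q)
... | tri> _ _ gt with c , c<p , πp<πc ← larger-before π p q p<q gt πp≤p
  = ⊥-elim (av c p q c<p p<q (πp<πc , gt))

Exc : S₃₂₁ n → Antichain n
Exc {n} π′@(π avoiding _) = record
  { elems     = ExcSet π
  ; elems?    = λ x → any? λ p → (p Finₚ.<? π ⟨$⟩ʳ p)
                  ×-dec (lo x ≟ suc (toℕ p)) ×-dec (hi x ≟ toℕ (π ⟨$⟩ʳ p))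
  ; antichain = anti
  }
  where
  anti : ∀ {x y} → ExcSet π x → ExcSet π y → x ⊑ y → x ≡ y
  anti {x} {y} (p , p<πp , lx , hx) (q , q<πq , ly , hy) (lo≤ , hi≤)
    with Finₚ.<-cmp p q
  ... | tri≈ _ refl _ = Interval-≡ (trans lx (sym ly)) (trans hx (sym hy))
  ... | tri< p<q _ _ = ⊥-elim (<⇒≱ (s≤s p<q) (subst (_≤ suc (toℕ p)) ly (subst (lo y ≤_) lx lo≤)))
  ... | tri> _ _ q<p = ⊥-elim (<⇒≱ (excedances-increase π′ q<p p<πp)
                         (subst (_≤ toℕ (π ⟨$⟩ʳ q)) hx (subst (hi x ≤_) hy hi≤)))

------------------------------------------------------------------------
-- Exc is injective

ExcSet⊆ : Permutation′ n → Permutation′ n → Set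
ExcSet⊆ π σ = ∀ x → ExcSet π x → ExcSet σ x

exc-value : (π σ : Permutation′ n) → ExcSet⊆ π σ → ∀ p → p Fin.< π ⟨$⟩ʳ p → σ ⟨$⟩ʳ p ≡ π ⟨$⟩ʳ p
exc-value π σ π⊆σ p p<πp
  with q , _ , lq , hq ← π⊆σ [ suc (toℕ p) , toℕ (π ⟨$⟩ʳ p) ∣ s≤s z≤n , p<πp , toℕ<n _ ]
                            (p , p<πp , refl , refl)
  with refl ← toℕ-injective {i = p} {q} (suc-injective lq)
  = sym (toℕ-injective hq)

-- If π and σ agree before p, and π(p) < σ(p) with p not an excedance of
-- σ, the value π(p) has no preimage under σ.
no-smaller : (π σ : S₃₂₁ n) → ExcSet⊆ (perm σ) (perm π) → (p : Fin n) →
  (∀ q → q Fin.< p → perm π ⟨$⟩ʳ q ≡ perm σ ⟨$⟩ʳ q) →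
  perm σ ⟨$⟩ʳ p Fin.≤ p → ¬ (perm π ⟨$⟩ʳ p Fin.< perm σ ⟨$⟩ʳ p)
no-smaller π′@(π avoiding _) σ′@(σ avoiding _) σ⊆π p agree σp≤p πp<σp
  with Finₚ.<-cmp p q
  where q = σ ⟨$⟩ˡ (π ⟨$⟩ʳ p)
... | tri≈ _ p≡q _ = <-irrefl (cong toℕ (sym (trans (cong (σ ⟨$⟩ʳ_) p≡q) (inverseʳ σ)))) πp<σp
... | tri< p<q _ _ = <-asym πp<σp
        (subst (σ ⟨$⟩ʳ p Fin.<_) (inverseʳ σ) (nonexcedances-increase σ′ p<q σp≤p))
... | tri> _ _ q<p = <-irrefl (cong toℕ
        (perm-injective π (trans (agree _ q<p) (inverseʳ σ)))) q<p

Exc-injective : (π σ : S₃₂₁ n) → elems (Exc π) ≐ elems (Exc σ) → perm π Perm.≈ perm σ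
Exc-injective {n} π σ (sub , sup) p = go (suc (toℕ p)) p ≤-refl
  where
  π⊆σ : ExcSet⊆ (perm π) (perm σ)
  π⊆σ x = sub {x}

  σ⊆π : ExcSet⊆ (perm σ) (perm π)
  σ⊆π x = sup {x}

  go : ∀ k (p : Fin n) → toℕ p < k → perm π ⟨$⟩ʳ p ≡ perm σ ⟨$⟩ʳ p
  go (suc k) p p<k with p Finₚ.<? perm π ⟨$⟩ʳ p | p Finₚ.<? perm σ ⟨$⟩ʳ p
  ... | yes e | _ = sym (exc-value (perm π) (perm σ) π⊆σ p e)
  ... | no _ | yes e = exc-value (perm σ) (perm π) σ⊆π p e
  ... | no ¬e | no ¬e′ with Finₚ.<-cmp (perm π ⟨$⟩ʳ p) (perm σ ⟨$⟩ʳ p)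
  ...   | tri≈ _ eq _ = eq
  ...   | tri< lt _ _ = ⊥-elim (no-smaller π σ σ⊆π p
            (λ q q<p → go k q (≤-trans q<p (s≤s⁻¹ p<k))) (≮⇒≥ ¬e′) lt)
  ...   | tri> _ _ gt = ⊥-elim (no-smaller σ π π⊆σ p
            (λ q q<p → sym (go k q (≤-trans q<p (s≤s⁻¹ p<k)))) (≮⇒≥ ¬e) gt)

------------------------------------------------------------------------
-- Exc is surjective

-- The cycle p ↦ q, with v ↦ v - 1 for p < v ≤ q.
record IsCycle (c : Permutation′ n) (p q : Fin n) : Set where
  field
    at-p  : c ⟨$⟩ʳ p ≡ q
    below : ∀ v → v Fin.< p → c ⟨$⟩ʳ v ≡ v
    above : ∀ v → q Fin.< v → c ⟨$⟩ʳ v ≡ v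
    lower : ∀ v → p Fin.< v → p Fin.≤ c ⟨$⟩ʳ v
    upper : ∀ v → p Fin.< v → c ⟨$⟩ʳ v Fin.≤ v
    mono  : ∀ v w → p Fin.< v → v Fin.< w → c ⟨$⟩ʳ v Fin.< c ⟨$⟩ʳ w

punchIn-≤ : (i : Fin (suc n)) (j : Fin n) → toℕ j < toℕ i → toℕ (punchIn i j) ≡ toℕ j
punchIn-≤ (suc i) zero    _         = refl
punchIn-≤ (suc i) (suc j) (s≤s j<i) = cong suc (punchIn-≤ i j j<i)

punchIn-> : (i : Fin (suc n)) (j : Fin n) → toℕ i ≤ toℕ j → toℕ (punchIn i j) ≡ suc (toℕ j)
punchIn-> zero    j       _         = refl
punchIn-> (suc i) (suc j) (s≤s i≤j) = cong suc (punchIn-> i j i≤j)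

toℕ≤punchIn : (i : Fin (suc n)) (j : Fin n) → toℕ j ≤ toℕ (punchIn i j)
toℕ≤punchIn zero    j       = n≤1+n _
toℕ≤punchIn (suc i) zero    = z≤n
toℕ≤punchIn (suc i) (suc j) = s≤s (toℕ≤punchIn i j)

punchIn≤suc : (i : Fin (suc n)) (j : Fin n) → toℕ (punchIn i j) ≤ suc (toℕ j)
punchIn≤suc zero    j       = ≤-refl
punchIn≤suc (suc i) zero    = z≤n
punchIn≤suc (suc i) (suc j) = s≤s (punchIn≤suc i j)

punchOut-< : {i j : Fin (suc n)} (i≢j : i ≢ j) → toℕ j < toℕ i → toℕ (punchOut i≢j) ≡ toℕ j
punchOut-< {suc n} {suc i} {zero}  _   _         = refl
punchOut-< {suc n} {suc i} {suc j} i≢j (s≤s j<i) = cong suc (punchOut-< (i≢j ∘ cong suc) j<i)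

punchOut-> : {i j : Fin (suc n)} (i≢j : i ≢ j) → toℕ i < toℕ j → suc (toℕ (punchOut i≢j)) ≡ toℕ j
punchOut-> {_}     {zero}  {suc j} _   _         = refl
punchOut-> {suc n} {suc i} {suc j} i≢j (s≤s i<j) = cong suc (punchOut-> (i≢j ∘ cong suc) i<j)

cycle : (p q : Fin n) → p Fin.≤ q → Σ (Permutation′ n) λ c → IsCycle c p q
cycle {suc n} p q p≤q = c , record
  { at-p  = at-p
  ; below = λ v v<p → toℕ-injective (below v v<p)
  ; above = λ v q<v → toℕ-injective (above v q<v)
  ; lower = lower
  ; upper = upper
  ; mono  = λ v w p<v v<w → Finₚ.≤∧≢⇒< (mono v w p<v v<w)
              λ e → <-irrefl (cong toℕ (perm-injective c e)) v<w
  }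
  where
  c : Permutation′ (suc n)
  c = insert p q Perm.id

  at-p : c ⟨$⟩ʳ p ≡ q
  at-p with p Finₚ.≟ p
  ... | yes _  = refl
  ... | no p≢p = ⊥-elim (p≢p refl)

  off-p : ∀ v (p≢v : p ≢ v) → c ⟨$⟩ʳ v ≡ punchIn q (punchOut p≢v)
  off-p v p≢v with p Finₚ.≟ v
  ... | yes p≡v = ⊥-elim (p≢v p≡v)
  ... | no p≢v′ = cong (punchIn q) (Finₚ.punchOut-cong p refl)

  <⇒≢ᶠ : ∀ {v w : Fin (suc n)} → v Fin.< w → v ≢ w
  <⇒≢ᶠ v<w refl = <-irrefl refl v<w

  below : ∀ v → v Fin.< p → toℕ (c ⟨$⟩ʳ v) ≡ toℕ v
  below v v<p rewrite off-p v (<⇒≢ᶠ v<p ∘ sym) =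
    trans (punchIn-≤ q _ (subst (_< toℕ q) (sym e) (<-≤-trans v<p p≤q))) e
    where e = punchOut-< (<⇒≢ᶠ v<p ∘ sym) v<p

  above : ∀ v → q Fin.< v → toℕ (c ⟨$⟩ʳ v) ≡ toℕ v
  above v q<v rewrite off-p v (<⇒≢ᶠ (≤-<-trans p≤q q<v)) =
    trans (punchIn-> q _ (s≤s⁻¹ (subst (toℕ q <_) (sym e) q<v))) e
    where e = punchOut-> (<⇒≢ᶠ (≤-<-trans p≤q q<v)) (≤-<-trans p≤q q<v)

  lower : ∀ v → p Fin.< v → p Fin.≤ c ⟨$⟩ʳ v
  lower v p<v rewrite off-p v (<⇒≢ᶠ p<v) =
    ≤-trans (s≤s⁻¹ (subst (toℕ p <_) (sym (punchOut-> (<⇒≢ᶠ p<v) p<v)) p<v)) (toℕ≤punchIn q _)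

  upper : ∀ v → p Fin.< v → c ⟨$⟩ʳ v Fin.≤ v
  upper v p<v rewrite off-p v (<⇒≢ᶠ p<v) =
    subst (toℕ (punchIn q v′) ≤_) (punchOut-> (<⇒≢ᶠ p<v) p<v) (punchIn≤suc q v′)
    where v′ = punchOut (<⇒≢ᶠ p<v)

  mono : ∀ v w → p Fin.< v → v Fin.< w → c ⟨$⟩ʳ v Fin.≤ c ⟨$⟩ʳ w
  mono v w p<v v<w
    rewrite off-p v (<⇒≢ᶠ p<v) | off-p w (<⇒≢ᶠ (<-trans p<v v<w)) =
    Finₚ.punchIn-mono-≤ q _ _
      (Finₚ.punchOut-mono-≤ (<⇒≢ᶠ p<v) (<⇒≢ᶠ (<-trans p<v v<w)) (<⇒≤ v<w))

module Preimage {n} (A : Antichain n) where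

  Start : Fin n → Set
  Start p = ∃ λ x → elems A x × lo x ≡ suc (toℕ p)

  Start? : Decidable Start
  Start? p = anyInterval? λ x → elems? A x ×-dec (lo x ≟ suc (toℕ p))

  lo<⇒hi< : ∀ {x y} → elems A x → elems A y → lo x < lo y → hi x < hi y
  lo<⇒hi< {x} {y} x∈ y∈ lt with hi x <? hi y
  ... | yes h = h
  ... | no ¬h = ⊥-elim (<-irrefl (sym (cong lo (antichain A y∈ x∈ (<⇒≤ lt , ≮⇒≥ ¬h)))) lt)

  lo-injective : ∀ {x y} → elems A x → elems A y → lo x ≡ lo y → x ≡ y
  lo-injective {x} {y} x∈ y∈ e with ≤-total (hi x) (hi y)
  ... | inj₁ h = antichain A x∈ y∈ (≤-reflexive (sym e) , h)
  ... | inj₂ h = sym (antichain A y∈ x∈ (≤-reflexive e , h))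

  record Partial (k : ℕ) (π : Permutation′ n) : Set where
    field
      fixed : ∀ p → toℕ p < k → π ⟨$⟩ʳ p ≡ p
      start : ∀ p x → k ≤ toℕ p → elems A x → lo x ≡ suc (toℕ p) → toℕ (π ⟨$⟩ʳ p) ≡ hi x
      lower : ∀ p → k ≤ toℕ p → ¬ Start p → k ≤ toℕ (π ⟨$⟩ʳ p)
      upper : ∀ p → k ≤ toℕ p → ¬ Start p → π ⟨$⟩ʳ p Fin.≤ p
      mono  : ∀ p q → k ≤ toℕ p → ¬ Start p → ¬ Start q → p Fin.< q →
              π ⟨$⟩ʳ p Fin.< π ⟨$⟩ʳ q

  step : (p₀ : Fin n) (π : Permutation′ n) → Partial (suc (toℕ p₀)) π →
         Σ (Permutation′ n) (Partial (toℕ p₀))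
  step p₀ π inv with Start? p₀
  ... | no ¬s = π , record
    { fixed = λ p p<k → I.fixed p (m<n⇒m<1+n p<k)
    ; start = start
    ; lower = lower
    ; upper = upper
    ; mono  = mono
    }
    where
    module I = Partial inv

    π₀ : π ⟨$⟩ʳ p₀ ≡ p₀
    π₀ = I.fixed p₀ ≤-refl

    split : ∀ p → toℕ p₀ ≤ toℕ p → p₀ ≡ p ⊎ p₀ Fin.< p
    split p le with m≤n⇒m<n∨m≡n le
    ... | inj₁ lt = inj₂ lt
    ... | inj₂ e  = inj₁ (toℕ-injective e)

    start : ∀ p x → toℕ p₀ ≤ toℕ p → elems A x → lo x ≡ suc (toℕ p) → toℕ (π ⟨$⟩ʳ p) ≡ hi x
    start p x le x∈ e with split p le
    ... | inj₁ refl = ⊥-elim (¬s (x , x∈ , e))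
    ... | inj₂ lt   = I.start p x lt x∈ e

    lower : ∀ p → toℕ p₀ ≤ toℕ p → ¬ Start p → toℕ p₀ ≤ toℕ (π ⟨$⟩ʳ p)
    lower p le ¬sp with split p le
    ... | inj₁ refl = ≤-reflexive (cong toℕ (sym π₀))
    ... | inj₂ lt   = <⇒≤ (I.lower p lt ¬sp)

    upper : ∀ p → toℕ p₀ ≤ toℕ p → ¬ Start p → π ⟨$⟩ʳ p Fin.≤ p
    upper p le ¬sp with split p le
    ... | inj₁ refl = ≤-reflexive (cong toℕ π₀)
    ... | inj₂ lt   = I.upper p lt ¬sp

    mono : ∀ p q → toℕ p₀ ≤ toℕ p → ¬ Start p → ¬ Start q → p Fin.< q →
           π ⟨$⟩ʳ p Fin.< π ⟨$⟩ʳ q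
    mono p q le ¬sp ¬sq p<q with split p le
    ... | inj₁ refl = subst (Fin._< π ⟨$⟩ʳ q) (sym π₀) (I.lower q p<q ¬sq)
    ... | inj₂ lt   = I.mono p q lt ¬sp ¬sq p<q

  ... | yes (x₀ , x₀∈ , lo₀) = π ∘ₚ c , record
    { fixed = λ p p<k → trans (cong (c ⟨$⟩ʳ_) (I.fixed p (m<n⇒m<1+n p<k))) (C.below p p<k)
    ; start = start
    ; lower = λ p le ¬s → C.lower _ (I.lower p (after p le ¬s) ¬s)
    ; upper = λ p le ¬s → ≤-trans (C.upper _ (I.lower p (after p le ¬s) ¬s))
                                  (I.upper p (after p le ¬s) ¬s)
    ; mono  = λ p q le ¬sp ¬sq p<q →
        C.mono _ _ (I.lower p (after p le ¬sp) ¬sp) (I.mono p q (after p le ¬sp) ¬sp ¬sq p<q)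
    }
    where
    module I = Partial inv

    q₀ : Fin n
    q₀ = fromℕ< (hi<n x₀)

    q₀≡ : toℕ q₀ ≡ hi x₀
    q₀≡ = toℕ-fromℕ< (hi<n x₀)

    p₀≤q₀ : p₀ Fin.≤ q₀
    p₀≤q₀ = subst (toℕ p₀ ≤_) (sym q₀≡) (<⇒≤ (subst (_≤ hi x₀) lo₀ (lo≤hi x₀)))

    c = proj₁ (cycle p₀ q₀ p₀≤q₀)
    module C = IsCycle (proj₂ (cycle p₀ q₀ p₀≤q₀))

    after : ∀ p → toℕ p₀ ≤ toℕ p → ¬ Start p → p₀ Fin.< p
    after p le ¬s = ≤∧≢⇒< le λ e → ¬s (x₀ , x₀∈ , trans lo₀ (cong suc e))

    start : ∀ p x → toℕ p₀ ≤ toℕ p → elems A x → lo x ≡ suc (toℕ p) →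
            toℕ (c ⟨$⟩ʳ (π ⟨$⟩ʳ p)) ≡ hi x
    start p x le x∈ e with m≤n⇒m<n∨m≡n le
    ... | inj₁ lt = trans (cong toℕ (C.above _
            (subst₂′ (sym q₀≡) (sym πp) (lo<⇒hi< x₀∈ x∈
              (subst₂′ (sym lo₀) (sym e) (s≤s lt)))))) πp
      where
      πp = I.start p x lt x∈ e

      subst₂′ : ∀ {a b a′ b′} → a′ ≡ a → b′ ≡ b → a′ < b′ → a < b
      subst₂′ refl refl z = z
    ... | inj₂ p₀≡p with refl ← toℕ-injective {i = p₀} {p} p₀≡p =
      trans (cong (λ v → toℕ (c ⟨$⟩ʳ v)) (I.fixed p₀ ≤-refl))
        (trans (cong toℕ C.at-p)
          (trans q₀≡ (cong hi (lo-injective x₀∈ x∈ (trans lo₀ (sym e))))))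

  build : ∀ d k → d + k ≡ n → Σ (Permutation′ n) (Partial k)
  build zero k refl = Perm.id , record
    { fixed = λ _ _ → refl
    ; start = λ p _ n≤p → ⊥-elim (<⇒≱ (toℕ<n p) n≤p)
    ; lower = λ p n≤p → ⊥-elim (<⇒≱ (toℕ<n p) n≤p)
    ; upper = λ p n≤p → ⊥-elim (<⇒≱ (toℕ<n p) n≤p)
    ; mono  = λ p _ n≤p → ⊥-elim (<⇒≱ (toℕ<n p) n≤p)
    }
  build (suc d) k e with π , inv ← build d (suc k) (trans (+-suc d k) e) =
    subst (λ j → Σ (Permutation′ n) (Partial j)) p₀≡
      (step p₀ π (subst (λ j → Partial (suc j) π) (sym p₀≡) inv))
    where
    k<n : k < n
    k<n = subst (k <_) e (s≤s (m≤n+m k d))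

    p₀ : Fin n
    p₀ = fromℕ< k<n

    p₀≡ : toℕ p₀ ≡ k
    p₀≡ = toℕ-fromℕ< k<n

  π : Permutation′ n
  π = proj₁ (build n 0 (+-identityʳ n))

  open Partial (proj₂ (build n 0 (+-identityʳ n)))

  start-exc : ∀ p → Start p → p Fin.< π ⟨$⟩ʳ p
  start-exc p (x , x∈ , e) =
    subst (toℕ p <_) (sym (start p x z≤n x∈ e)) (subst (_≤ hi x) e (lo≤hi x))

  inversion : ∀ p q → p Fin.< q → π ⟨$⟩ʳ q Fin.< π ⟨$⟩ʳ p → Start p × ¬ Start q
  inversion p q p<q πq<πp with Start? p | Start? q
  ... | yes s | no ¬s = s , ¬s
  ... | no ¬s | no ¬t = ⊥-elim (<-asym πq<πp (mono p q z≤n ¬s ¬t p<q))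
  ... | no ¬s | yes t =
    ⊥-elim (<-asym πq<πp (≤-<-trans (upper p z≤n ¬s) (<-trans p<q (start-exc q t))))
  ... | yes (x , x∈ , e) | yes (y , y∈ , f) = ⊥-elim (<-asym πq<πp
    (subst (_< toℕ (π ⟨$⟩ʳ q)) (sym (start p x z≤n x∈ e))
      (subst (hi x <_) (sym (start q y z≤n y∈ f))
        (lo<⇒hi< x∈ y∈ (subst (_< lo y) (sym e) (subst (suc (toℕ p) <_) (sym f) (s≤s p<q)))))))

  preimage : S₃₂₁ n
  preimage = π avoiding λ i j k i<j j<k (πj<πi , πk<πj) →
    proj₂ (inversion i j i<j πj<πi) (proj₁ (inversion j k j<k πk<πj))

  Exc-preimage : elems (Exc preimage) ≐ elems A
  Exc-preimage = to , from
    where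
    to : ∀ {x} → ExcSet π x → elems A x
    to {x} (p , p<πp , lx , hx) with Start? p
    ... | no ¬s = ⊥-elim (<⇒≱ p<πp (upper p z≤n ¬s))
    ... | yes (y , y∈ , e) = subst (elems A)
      (Interval-≡ (trans e (sym lx)) (trans (sym (start p y z≤n y∈ e)) (sym hx))) y∈

    from : ∀ {x} → elems A x → ExcSet π x
    from {x@([ suc l , h ∣ _ , l<h , h<n ])} x∈ =
      p , start-exc p (x , x∈ , lo≡) , lo≡ , sym (start p x z≤n x∈ lo≡)
      where
      l<n = <-trans l<h h<n
      p = fromℕ< l<n
      lo≡ : suc l ≡ suc (toℕ p)
      lo≡ = cong suc (sym (toℕ-fromℕ< l<n))

Exc-cong : {π σ : S₃₂₁ n} → perm π Perm.≈ perm σ → elems (Exc π) ≐ elems (Exc σ)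
Exc-cong {π = π} {σ} π≈σ =
  (λ (p , r , s , t) → p , subst (p Fin.<_) (π≈σ p) r , s , trans t (cong toℕ (π≈σ p))) ,
  (λ (p , r , s , t) → p , subst (p Fin.<_) (sym (π≈σ p)) r , s , trans t (cong toℕ (sym (π≈σ p))))

Exc-bijection : ∀ n → Bijection (S₃₂₁-setoid n) (Antichain-setoid n)
Exc-bijection n = record
  { to        = Exc
  ; cong      = λ {π} {σ} → Exc-cong {π = π} {σ}
  ; bijective = (λ {π} {σ} → Exc-injective π σ) , λ A →
      Preimage.preimage A , λ {π} π≈ →
        Setoid.trans (Antichain-setoid n) {Exc π} {Exc (Preimage.preimage A)} {A}
          (Exc-cong {π = π} {Preimage.preimage A} π≈) (Preimage.Exc-preimage A)
  }

Exc⁻¹ : Antichain n → S₃₂₁ n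
Exc⁻¹ = Bijection.to⁻ (Exc-bijection _)

ρS : S₃₂₁ n → S₃₂₁ n
ρS = Exc⁻¹ ∘ ρ𝒜 ∘ Exc

------------------------------------------------------------------------
-- Homomesy

module _ (X : Setoid a ℓ) where

  open Setoid X using (Carrier; _≈_)

  -- O lists, without repetition, the orbit {f ᵏ(x) : k ≥ 0} of some x.
  -- Nonnegative powers suffice when f is a bijection of a finite set.
  IsOrbit : (Carrier → Carrier) → List⁺ Carrier → Set (a ⊔ ℓ)
  IsOrbit f O = Unique X (toList O) ×
    ∃ λ x → ∀ y → _∈_ X y (toList O) ⇔ (∃ λ k → iterate f x k ≈ y)

  average : (Carrier → ℕ) → List⁺ Carrier → ℚ
  average stat O@(x ∷ xs) = + sum (map stat (toList O)) / suc (length xs)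

  Mesic : ℚ → (Carrier → Carrier) → (Carrier → ℕ) → Set (a ⊔ ℓ)
  Mesic c f stat = ∀ O → IsOrbit f O → average stat O ≡ c

-- For p ≤ n - 1, p is an excedance of ρS π exactly when p + 1 is a weak
-- excedance of π.  As 1 is always a weak excedance and n is never an
-- excedance, fp π + exc π = exc (ρS π) + 1.  Over an orbit the exc terms
-- cancel, because the injection ρS permutes the orbit.

module Submission where

open import Defs
open import Data.Nat.Base using (ℕ; _≥_)
open import Data.Rational.Base using (1ℚ)

open import Algebra.Properties.CommutativeMonoid.Sum as Sum using ()
open import Data.Bool.Base using (true; false; if_then_else_)
open import Data.Empty using (⊥-elim)
open import Data.Fin.Base as Fin using (Fin; zero; suc; toℕ; fromℕ; fromℕ<; inject₁)
open import Data.Fin.Permutation using (_⟨$⟩ʳ_; _⟨$⟩ˡ_; inverseˡ; inverseʳ; flip)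
open import Data.Fin.Properties as Finₚ
  using (toℕ<n; toℕ≤pred[n]; toℕ-injective; toℕ-inject₁; injective⇒≤)
import Data.Integer.Base as ℤ
import Data.Integer.Properties as ℤₚ
open import Data.List.Base using (List; []; _∷_; _++_; length; map; filter; tabulate)
import Data.List.Membership.Setoid as Membership
import Data.List.Membership.Setoid.Properties as Membershipₚ
open import Data.List.NonEmpty using (_∷_; toList)
open import Data.List.Properties using (length-map)
import Data.List.Relation.Binary.Permutation.Setoid as Permutation
import Data.List.Relation.Binary.Permutation.Setoid.Properties as Permutationₚ
open import Data.List.Relation.Unary.All as All using ([]; _∷_)
open import Data.List.Relation.Unary.AllPairs using ([]; _∷_)
open import Data.List.Relation.Unary.Any using (here; there)
open import Data.List.Relation.Unary.Unique.Setoid using (Unique)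
import Data.List.Relation.Unary.Unique.Setoid.Properties as Uniqueₚ
open import Data.Nat.Base using (zero; suc; _+_; _∸_; _≤_; _<_; z≤n; s≤s; s≤s⁻¹)
open import Data.Nat.GeneralisedArithmetic using (iterate)
open import Data.Nat.ListAction using (sum)
open import Data.Nat.Properties
open import Algebra.Properties.CommutativeSemigroup +-commutativeSemigroup using (interchange)
open import Data.Product.Base using (∃; _×_; _,_; proj₁)
import Data.Rational.Properties as ℚₚ
open import Data.Rational.Unnormalised.Base using (mkℚᵘ; 1ℚᵘ; *≡*)
open import Data.Sum.Base using (inj₁; inj₂)
open import Function.Base using (_∘_)
open import Function.Bundles using (module Equivalence; _⇔_; mk⇔)
open import Level using (Level; 0ℓ)
open import Relation.Binary.Bundles using (Setoid)
open import Relation.Binary.Core using (_Preserves_⟶_)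
open import Relation.Binary.Definitions using (tri<; tri≈; tri>)
open import Relation.Binary.PropositionalEquality
  using (_≡_; _≢_; refl; sym; trans; cong; cong₂; subst; subst₂; setoid; module ≡-Reasoning)
open import Relation.Nullary using (¬_; Dec; yes; no; does)
open import Relation.Nullary.Decidable
  using (_×-dec_; ¬?; decidable-stable; dec-true; dec-false; does-⇔)
open import Relation.Unary using (Pred; Decidable; _≐_)
open import Relation.Unary.Properties using (≐-sym; ≐-trans)

private variable
  a ℓ : Level
  n : ℕ

open Sum +-0-commutativeMonoid using (sum-cong-≗; ∑-distrib-+; sum-init-last)
  renaming (sum to ∑)

-- Homomesy of coboundaries

module _ (X : Setoid a ℓ) where

  open Setoid X using (Carrier; _≈_) renaming (refl to ≈-refl; sym to ≈-sym; trans to ≈-trans)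
  open Membership X using (_∈_)
  open Permutation X
    using (_↭_; ↭-refl; ↭-sym; ↭-trans; ↭-prep; prep; ↭-reflexive-≋)
  open Permutationₚ X using (∈-resp-↭; ↭-shift; xs↭ys⇒|xs|≡|ys|)

  ∈-∃↭ : ∀ {x ys} → x ∈ ys → ∃ λ zs → ys ↭ x ∷ zs
  ∈-∃↭ x∈ys with hs , ts , w , x≈w , ys≋ ← Membershipₚ.∈-∃++ X x∈ys =
    hs ++ ts , ↭-trans (↭-reflexive-≋ ys≋)
                 (↭-trans (↭-shift hs ts) (prep (≈-sym x≈w) ↭-refl))

  -- Pigeonhole by induction on `xs`: a match for the head is moved to the front of `ys` and
  -- removed. Since the head does not recur in the tail, the tail still embeds in what remains, and
  -- the lengths still agree.
  unique∧⊆∧length⇒↭ : ∀ {xs ys} → Unique X xs → (∀ {z} → z ∈ xs → z ∈ ys) →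
                      length xs ≡ length ys → xs ↭ ys
  unique∧⊆∧length⇒↭ {[]} {[]} _ _ _ = ↭-refl
  unique∧⊆∧length⇒↭ {x ∷ xs} (x∉xs ∷ xs!) sub len
    with zs , ys↭ ← ∈-∃↭ (sub (here ≈-refl)) =
    ↭-trans (↭-prep x (unique∧⊆∧length⇒↭ xs! sub′
              (suc-injective (trans len (xs↭ys⇒|xs|≡|ys| ys↭)))))
            (↭-sym ys↭)
    where
    sub′ : ∀ {z} → z ∈ xs → z ∈ zs
    sub′ z∈xs with ∈-resp-↭ ys↭ (sub (there z∈xs))
    ... | there z∈zs = z∈zs
    ... | here z≈x = ⊥-elim
      (All.lookupₛ X (λ e x≉ x≈ → x≉ (≈-trans x≈ (≈-sym e))) x∉xs z∈xs (≈-sym z≈x))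

  -- `iterate` applies the first `f` to the starting point; closure of an orbit under `f` needs the
  -- last one on the outside.
  iterate-suc : (f : Carrier → Carrier) (x : Carrier) (k : ℕ) →
                iterate f x (suc k) ≡ f (iterate f x k)
  iterate-suc f x zero    = refl
  iterate-suc f x (suc k) = iterate-suc f (f x) k

  -- An orbit is closed under `f`, and injectivity keeps the image list free of repetitions. Having
  -- the same length as the orbit, the image must exhaust it.
  orbit-↭ : (f : Carrier → Carrier) → f Preserves _≈_ ⟶ _≈_ →
            (∀ {x y} → f x ≈ f y → x ≈ y) →
            ∀ O → IsOrbit X f O → map f (toList O) ↭ toList O
  orbit-↭ f f-cong f-inj (o ∷ os) (O! , x , orbit) =
    unique∧⊆∧length⇒↭ (Uniqueₚ.map⁺ X X f-inj O!) closed (length-map f (o ∷ os))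
    where
    closed : ∀ {z} → z ∈ map f (o ∷ os) → z ∈ o ∷ os
    closed z∈ with y , y∈ , z≈fy ← Membershipₚ.∈-map⁻ X X z∈
              with k , fᵏx≈y ← Equivalence.to (orbit y) y∈ =
      Equivalence.from (orbit _) (suc k ,
        ≈-trans (Setoid.reflexive X (iterate-suc f x k))
          (≈-trans (f-cong fᵏx≈y) (≈-sym z≈fy)))

  sum-map-↭ : (e : Carrier → ℕ) → e Preserves _≈_ ⟶ _≡_ →
              ∀ {xs ys} → xs ↭ ys → sum (map e xs) ≡ sum (map e ys)
  sum-map-↭ e e-cong p = Permutationₚ.foldr-commMonoid (setoid ℕ) +-0-isCommutativeMonoid
    (Permutationₚ.map⁺ X (setoid ℕ) e-cong p)

  -- The relation `stat = 1 + e ∘ f - e`, written additively to stay in `ℕ`, summed over a list.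
  sum-map-coboundary : (f : Carrier → Carrier) (stat e : Carrier → ℕ) →
    (∀ y → stat y + e y ≡ suc (e (f y))) →
    ∀ xs → sum (map stat xs) + sum (map e xs) ≡ length xs + sum (map e (map f xs))
  sum-map-coboundary f stat e eq [] = refl
  sum-map-coboundary f stat e eq (x ∷ xs) = begin
    (stat x + sum (map stat xs)) + (e x + sum (map e xs))
      ≡⟨ interchange (stat x) _ (e x) _ ⟩
    (stat x + e x) + (sum (map stat xs) + sum (map e xs))
      ≡⟨ cong₂ _+_ (eq x) (sum-map-coboundary f stat e eq xs) ⟩
    (1 + e (f x)) + (length xs + sum (map e (map f xs)))
      ≡⟨ interchange 1 (e (f x)) (length xs) _ ⟩
    suc (length xs) + (e (f x) + sum (map e (map f xs))) ∎
    where open ≡-Reasoning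

  coboundary⇒1-mesic : (f : Carrier → Carrier) → (∀ x y → x ≈ y → f x ≈ f y) →
    (∀ x y → f x ≈ f y → x ≈ y) →
    (stat e : Carrier → ℕ) → (∀ x y → x ≈ y → e x ≡ e y) →
    (∀ y → stat y + e y ≡ suc (e (f y))) → Mesic X 1ℚ f stat
  coboundary⇒1-mesic f f-cong f-inj stat e e-cong eq O@(o ∷ os) isOrbit =
    trans (ℚₚ./-cong {q₂ = suc (length os)} (cong ℤ.+_ total) refl)
      -- What is left is a fraction `k / k`, equal to 1 by cross-multiplying unnormalised rationals.
      (ℚₚ.fromℚᵘ-cong {mkℚᵘ (ℤ.+ suc (length os)) (length os)} {1ℚᵘ}
        (*≡* (ℤₚ.*-comm (ℤ.+ suc (length os)) (ℤ.+ 1))))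
    where
    xs : List Carrier
    xs = toList O

    total : sum (map stat xs) ≡ length xs
    total = +-cancelʳ-≡ (sum (map e xs)) _ _
      (trans (sum-map-coboundary f stat e eq xs)
        (cong (length xs +_) (sum-map-↭ e (e-cong _ _)
          (orbit-↭ f (f-cong _ _) (f-inj _ _) O isOrbit))))

-- Counting elements of Fin n

𝟙 : {P : Set} → Dec P → ℕ
𝟙 P? = if does P? then 1 else 0

count : {P : Pred (Fin n) 0ℓ} → Decidable P → ℕ
count P? = ∑ λ i → 𝟙 (P? i)

𝟙-⇔ : {P Q : Set} → P ⇔ Q → (P? : Dec P) (Q? : Dec Q) → 𝟙 P? ≡ 𝟙 Q?
𝟙-⇔ P⇔Q P? Q? = cong (if_then 1 else 0) (does-⇔ P⇔Q P? Q?)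

length-filter-tabulate : {A : Set} {P : Pred A 0ℓ} (P? : Decidable P) (f : Fin n → A) →
                         length (filter P? (tabulate f)) ≡ count (P? ∘ f)
length-filter-tabulate {zero}  P? f = refl
length-filter-tabulate {suc n} P? f with does (P? (f zero))
... | true  = cong suc (length-filter-tabulate P? (f ∘ suc))
... | false = length-filter-tabulate P? (f ∘ suc)

-- The order ideal of an antichain

↓? : (A : Antichain n) → Decidable (↓ (elems A))
↓? A x = anyInterval? λ y → elems? A y ×-dec (x ⊑? y)

⊑-trans : (x y z : Interval n) → x ⊑ y → y ⊑ z → x ⊑ z
⊑-trans _ _ _ (a , b) (c , d) = ≤-trans c a , ≤-trans b d

-- Descent on `hi ∸ lo`, which drops strictly along proper inclusion.
minimal-below : {P : Pred (Interval n) 0ℓ} → Decidable P →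
                ∀ x → P x → ∃ λ y → Minimal P y × y ⊑ x
minimal-below {n} {P} P? x Px = go (suc (hi x ∸ lo x)) x Px ≤-refl
  where
  shrink : ∀ (x y : Interval n) → y ⊑ x → y ≢ x → hi y ∸ lo y < hi x ∸ lo x
  shrink x y (lx≤ly , hy≤hx) y≢x with m≤n⇒m<n∨m≡n lx≤ly
  ... | inj₁ lx<ly = ≤-<-trans (∸-monoˡ-≤ (lo y) hy≤hx)
                       (∸-monoʳ-< lx<ly (≤-trans (lo≤hi y) hy≤hx))
  ... | inj₂ lx≡ly = subst (λ l → hi y ∸ l < hi x ∸ lo x) lx≡ly
    (∸-monoˡ-< (≤∧≢⇒< hy≤hx λ e → y≢x (Interval-≡ (sym lx≡ly) e))
      (subst (_≤ hi y) (sym lx≡ly) (lo≤hi y)))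

  go : ∀ k x → P x → hi x ∸ lo x < k → ∃ λ y → Minimal P y × y ⊑ x
  go (suc k) x Px x<k with anyInterval? (λ y → P? y ×-dec (y ⊑? x) ×-dec ¬? (y ≟ᴵ x))
  ... | no none = x , (Px , λ y Py y⊑x → decidable-stable (y ≟ᴵ x)
                        λ y≢x → none (y , Py , y⊑x , y≢x)) , ≤-refl , ≤-refl
  ... | yes (y , Py , y⊑x , y≢x)
    with z , z-min , z⊑y ← go k y Py (<-≤-trans (shrink x y y⊑x y≢x) (s≤s⁻¹ x<k)) =
    z , z-min , ⊑-trans z y x z⊑y y⊑x

-- Congruence and injectivity of antichain rowmotion

ρ𝒜-⊆ : (A B : Antichain n) → (∀ {x} → elems A x → elems B x) →
        (∀ {x} → elems B x → elems A x) → ∀ {x} → elems (ρ𝒜 A) x → elems (ρ𝒜 B) x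
ρ𝒜-⊆ A B A⊆B B⊆A {x} (x∉ , min) =
  (λ (y , y∈ , x⊑y) → x∉ (y , B⊆A y∈ , x⊑y)) ,
  λ y y∉ → min y λ (z , z∈ , y⊑z) → y∉ (z , A⊆B z∈ , y⊑z)

ρ𝒜-cong : (A B : Antichain n) → elems A ≐ elems B → elems (ρ𝒜 A) ≐ elems (ρ𝒜 B)
ρ𝒜-cong A B (A⊆B , B⊆A) =
  (λ {x} → ρ𝒜-⊆ A B A⊆B B⊆A {x}) , λ {x} → ρ𝒜-⊆ B A B⊆A A⊆B {x}

-- The complement of an ideal is the up-set of its minimal elements. If `x` were in the ideal of `A`
-- but not in that of `B`, some `y` in `ρ𝒜 B` would lie below `x`; it is then in `ρ𝒜 A`, hence
-- outside the ideal of `A`, which is closed downwards.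
ρ𝒜⊆⇒↓⊆ : (A B : Antichain n) → (∀ {x} → elems (ρ𝒜 B) x → elems (ρ𝒜 A) x) →
           ∀ {x} → ↓ (elems A) x → ↓ (elems B) x
ρ𝒜⊆⇒↓⊆ A B ρB⊆ρA {x} (z , z∈A , x⊑z) = decidable-stable (↓? B x) λ x∉↓B →
  let y , y∈ρB , y⊑x = minimal-below (¬? ∘ ↓? B) x x∉↓B
  in proj₁ (ρB⊆ρA {y} y∈ρB) (z , z∈A , ⊑-trans y x z y⊑x x⊑z)

-- An antichain consists of the maximal elements of its ideal: a chain from `x` in `A` through `y`
-- in `B` back to `A` must collapse.
↓-injective : (A B : Antichain n) → (∀ {x} → ↓ (elems A) x → ↓ (elems B) x) →
              (∀ {x} → ↓ (elems B) x → ↓ (elems A) x) → ∀ {x} → elems A x → elems B x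
↓-injective A B A⊆B B⊆A {x} x∈A
  with y , y∈B , x⊑y ← A⊆B {x} (x , x∈A , ≤-refl , ≤-refl)
  with z , z∈A , y⊑z ← B⊆A {y} (y , y∈B , ≤-refl , ≤-refl)
  with refl ← antichain A x∈A z∈A (⊑-trans x y z x⊑y y⊑z)
  = subst (elems B) (⊑-antisym y⊑z x⊑y) y∈B

ρ𝒜-injective : (A B : Antichain n) → elems (ρ𝒜 A) ≐ elems (ρ𝒜 B) → elems A ≐ elems B
ρ𝒜-injective A B (ρA⊆ρB , ρB⊆ρA) =
  (λ {x} → ↓-injective A B (λ {y} → A⊆B {y}) (λ {y} → B⊆A {y}) {x}) ,
  λ {x} → ↓-injective B A (λ {y} → B⊆A {y}) (λ {y} → A⊆B {y}) {x}
  where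
  A⊆B : ∀ {x} → ↓ (elems A) x → ↓ (elems B) x
  A⊆B {x} = ρ𝒜⊆⇒↓⊆ A B (λ {y} → ρB⊆ρA {y}) {x}
  B⊆A : ∀ {x} → ↓ (elems B) x → ↓ (elems A) x
  B⊆A {x} = ρ𝒜⊆⇒↓⊆ B A (λ {y} → ρA⊆ρB {y}) {x}

-- Rowmotion on permutations

infix 4 _≈ₛ_

_≈ₛ_ : S₃₂₁ n → S₃₂₁ n → Set
_≈ₛ_ {n} = Setoid._≈_ (S₃₂₁-setoid n)

Exc-ρS : (π : S₃₂₁ n) → elems (Exc (ρS π)) ≐ elems (ρ𝒜 (Exc π))
Exc-ρS π = Preimage.Exc-preimage (ρ𝒜 (Exc π))

-- Equality is tested after `Exc`, which turns `ρS` into `ρ𝒜`; `ρS-injective` proceeds the same way.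
ρS-cong : (π σ : S₃₂₁ n) → π ≈ₛ σ → ρS π ≈ₛ ρS σ
ρS-cong π σ π≈σ = Exc-injective (ρS π) (ρS σ)
  (≐-trans (Exc-ρS π) (≐-trans (ρ𝒜-cong (Exc π) (Exc σ) (Exc-cong {π = π} {σ} π≈σ))
    (≐-sym (Exc-ρS σ))))

ρS-injective : (π σ : S₃₂₁ n) → ρS π ≈ₛ ρS σ → π ≈ₛ σ
ρS-injective π σ ρπ≈ρσ = Exc-injective π σ (ρ𝒜-injective (Exc π) (Exc σ)
  (≐-trans (≐-sym (Exc-ρS π)) (≐-trans (Exc-cong {π = ρS π} {ρS σ} ρπ≈ρσ) (Exc-ρS σ))))

-- Weak excedances and prefix maxima

-- Extends `excedances-increase` to fixed points. If `π q` exceeded `π p`, pigeonhole for the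
-- inverse would give a value below `π p` at a position after `p`, completing a 321 pattern with `q`
-- and `p`.
weak-excedances-increase : (π : S₃₂₁ n) {p q : Fin n} →
  q Fin.< p → p Fin.≤ perm π ⟨$⟩ʳ p → perm π ⟨$⟩ʳ q Fin.< perm π ⟨$⟩ʳ p
weak-excedances-increase (π avoiding av) {p} {q} q<p p≤πp
  with Finₚ.<-cmp (π ⟨$⟩ʳ q) (π ⟨$⟩ʳ p)
... | tri< lt _ _ = lt
... | tri≈ _ eq _ = ⊥-elim (<-irrefl (cong toℕ (perm-injective π eq)) q<p)
... | tri> _ _ gt
  with c , c<πp , p<τc ← larger-before (flip π) (π ⟨$⟩ʳ p) (π ⟨$⟩ʳ q) gt
         (subst₂ Fin._<_ (sym (inverseˡ π)) (sym (inverseˡ π)) q<p)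
         (subst (Fin._≤ π ⟨$⟩ʳ p) (sym (inverseˡ π)) p≤πp)
  = ⊥-elim (av q p (π ⟨$⟩ˡ c) q<p (subst (Fin._< π ⟨$⟩ˡ c) (inverseˡ π) p<τc)
      (gt , subst (Fin._< π ⟨$⟩ʳ p) (sym (inverseʳ π)) c<πp))

argmax-upTo : (f : Fin n → ℕ) (p : Fin n) →
  ∃ λ i → i Fin.≤ p × (∀ j → j Fin.≤ p → f j ≤ f i)
argmax-upTo f zero = zero , z≤n , λ { zero _ → ≤-refl }
argmax-upTo f (suc p) with i , i≤p , max ← argmax-upTo (f ∘ suc) p | ≤-total (f zero) (f (suc i))
... | inj₁ f0≤fi = suc i , s≤s i≤p , λ { zero _ → f0≤fi ; (suc j) (s≤s j≤p) → max j j≤p }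
... | inj₂ fi≤f0 = zero , z≤n , λ { zero _ → ≤-refl 
                            ; (suc j) (s≤s j≤p) → ≤-trans (max j j≤p) fi≤f0 }

-- Pigeonhole: `π` injects the `p + 1` positions up to `p` into the `b + 1` values up to `b`.
bound-on-upTo : (π : S₃₂₁ n) (p b : Fin n) →
  (∀ j → j Fin.≤ p → perm π ⟨$⟩ʳ j Fin.≤ b) → p Fin.≤ b
bound-on-upTo {n} π p b bound = s≤s⁻¹ (injective⇒≤ g-injective)
  where
  pos : Fin (suc (toℕ p)) → Fin n
  pos c = Fin.inject≤ c (toℕ<n p)

  pos≤p : ∀ c → pos c Fin.≤ p
  pos≤p c = subst (_≤ toℕ p) (sym (Finₚ.toℕ-inject≤ c _)) (toℕ≤pred[n] c)

  g : Fin (suc (toℕ p)) → Fin (suc (toℕ b))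
  g c = fromℕ< (s≤s (bound (pos c) (pos≤p c)))

  g-injective : ∀ {c d} → g c ≡ g d → c ≡ d
  g-injective {c} {d} e = Finₚ.inject≤-injective _ _ c d (perm-injective (perm π)
    (toℕ-injective (Finₚ.fromℕ<-injective _ _ (s≤s (bound (pos c) (pos≤p c)))
                                              (s≤s (bound (pos d) (pos≤p d))) e)))

prefix-maximum : (π : S₃₂₁ n) (p : Fin n) →
  ∃ λ i → i Fin.≤ p × p Fin.≤ perm π ⟨$⟩ʳ i ×
          (∀ j → j Fin.≤ p → perm π ⟨$⟩ʳ j Fin.≤ perm π ⟨$⟩ʳ i)
prefix-maximum π p with i , i≤p , max ← argmax-upTo (toℕ ∘ (perm π ⟨$⟩ʳ_)) p =
  i , i≤p , bound-on-upTo π p (perm π ⟨$⟩ʳ i) max , max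

-- Lower ends of the rowmotion image

excInterval : (π : S₃₂₁ n) (i : Fin n) → i Fin.< perm π ⟨$⟩ʳ i → Interval n
excInterval π i i<πi = [ suc (toℕ i) , toℕ (perm π ⟨$⟩ʳ i) ∣ s≤s z≤n , i<πi , toℕ<n _ ]

-- The two bounds force `i` to be an excedance, since `lo x ≤ hi x`. With `↓⇒⊑-exc`, membership in
-- the ideal becomes a pair of inequalities on a position.
⊑-exc⇒↓ : (π : S₃₂₁ n) (x : Interval n) (i : Fin n) →
  suc (toℕ i) ≤ lo x → hi x ≤ toℕ (perm π ⟨$⟩ʳ i) → ↓ (elems (Exc π)) x
⊑-exc⇒↓ π x i i<lo hi≤πi = excInterval π i i<πi , (i , i<πi , refl , refl) , i<lo , hi≤πi
  where
  i<πi : i Fin.< perm π ⟨$⟩ʳ i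
  i<πi = ≤-trans i<lo (≤-trans (lo≤hi x) hi≤πi)

↓⇒⊑-exc : (π : S₃₂₁ n) (x : Interval n) → ↓ (elems (Exc π)) x →
  ∃ λ i → suc (toℕ i) ≤ lo x × hi x ≤ toℕ (perm π ⟨$⟩ʳ i)
↓⇒⊑-exc π x (y , (i , _ , loy , hiy) , lo≤ , hi≤) =
  i , subst (_≤ lo x) loy lo≤ , subst (hi x ≤_) hiy hi≤

module _ (π : S₃₂₁ n) {p q : Fin n} (q≡1+p : toℕ q ≡ suc (toℕ p)) where

  private
    f : Fin n → Fin n
    f = perm π ⟨$⟩ʳ_

    ≤q⇒≤p : ∀ {r} → r Fin.≤ q → r ≢ q → r Fin.≤ p
    ≤q⇒≤p r≤q r≢q = s≤s⁻¹ (subst (_ <_) q≡1+p (≤∧≢⇒< r≤q (r≢q ∘ toℕ-injective)))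

  -- By contradiction: if `q` is not a weak excedance, a long `x` is not minimal and a one-point `x`
  -- lies in the ideal. Because `lo` is 1-based and positions are 0-based, `lo x` equals `toℕ q`.
  ρ𝒜-lo⇒weak-exc : ∀ x → elems (ρ𝒜 (Exc π)) x → lo x ≡ suc (toℕ p) → q Fin.≤ f q
  ρ𝒜-lo⇒weak-exc x (x∉ , min) lox≡ with q Finₚ.≤? f q
  ... | yes q≤fq = q≤fq
  ... | no q≰fq with m≤n⇒m<n∨m≡n (lo≤hi x)
  ...   | inj₁ lo<hi =
    ⊥-elim (1+n≢n (cong lo (min y y∉ (n≤1+n _ , ≤-refl))))
    where
    -- `x` without its left endpoint; showing it outside the ideal contradicts minimality of `x`.
    y : Interval n
    y = [ suc (lo x) , hi x ∣ s≤s z≤n , lo<hi , hi<n x ]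

    y∉ : ¬ ↓ (elems (Exc π)) y
    -- The covering position `r` is at most `q`, and is not `q` because its value is at least
    -- `hi x ≥ lo x = q`. So `r ≤ p`, and it covers `x` as well.
    y∉ y∈ with r , r≤lox , hi≤fr ← ↓⇒⊑-exc π y y∈ =
      x∉ (⊑-exc⇒↓ π x r (subst (suc (toℕ r) ≤_) (sym lox≡) (s≤s (≤q⇒≤p r≤q r≢q))) hi≤fr)
      where
      q≡lox : toℕ q ≡ lo x
      q≡lox = trans q≡1+p (sym lox≡)

      r≤q : r Fin.≤ q
      r≤q = subst (toℕ r ≤_) (sym q≡lox) (s≤s⁻¹ r≤lox)

      r≢q : r ≢ q
      r≢q refl = q≰fq (≤-trans (≤-reflexive q≡lox) (≤-trans (lo≤hi x) hi≤fr))
  -- The prefix maximum up to `q` has value at least `q`, so it sits at a position other than `q`,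
  -- and covers the single point of `x`.
  ...   | inj₂ lo≡hi with i , i≤q , q≤fi , _ ← prefix-maximum π q =
    ⊥-elim (x∉ (⊑-exc⇒↓ π x i
      (subst (suc (toℕ i) ≤_) (sym lox≡) (s≤s (≤q⇒≤p i≤q λ { refl → q≰fq q≤fi })))
      (subst (_≤ toℕ (f i)) (trans q≡1+p (trans (sym lox≡) lo≡hi)) q≤fi)))

  -- The upper end is the 1-based maximum of π on the positions up to p.
  weak-exc⇒ρ𝒜-lo : q Fin.≤ f q → ∃ λ x → elems (ρ𝒜 (Exc π)) x × lo x ≡ suc (toℕ p)
  weak-exc⇒ρ𝒜-lo q≤fq with i , i≤p , p≤fi , max ← prefix-maximum π p =
    x , (x∉ , min) , refl
    where
    fi<fq : f i Fin.< f q
    -- The weak excedance enters here: strictness keeps the upper end of `x` below `n` and lets `q`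
    -- cover subintervals of `x` that start later.
    fi<fq = weak-excedances-increase π (subst (toℕ i <_) (sym q≡1+p) (s≤s i≤p)) q≤fq

    x : Interval n
    x = [ suc (toℕ p) , suc (toℕ (f i)) ∣ s≤s z≤n , s≤s p≤fi , ≤-<-trans fi<fq (toℕ<n (f q)) ]

    x∉ : ¬ ↓ (elems (Exc π)) x
    x∉ x∈ with r , s≤s r≤p , fi<fr ← ↓⇒⊑-exc π x x∈ = <⇒≱ fi<fr (max r r≤p)

    min : ∀ y → ¬ ↓ (elems (Exc π)) y → y ⊑ x → y ≡ x
    -- A proper subinterval loses an endpoint: `q` covers it if the left one is lost, `i` if the
    -- right one is.
    min y y∉ (p<loy , hiy≤) with m≤n⇒m<n∨m≡n p<loy
    ... | inj₁ q<loy = ⊥-elim (y∉ (⊑-exc⇒↓ π y q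
            (subst (λ k → suc k ≤ lo y) (sym q≡1+p) q<loy) (≤-trans hiy≤ fi<fq)))
    ... | inj₂ loy≡ with m≤n⇒m<n∨m≡n hiy≤
    ...   | inj₁ hiy< = ⊥-elim (y∉ (⊑-exc⇒↓ π y i (≤-trans (s≤s i≤p) p<loy) (s≤s⁻¹ hiy<)))
    ...   | inj₂ hiy≡ = Interval-≡ (sym loy≡) hiy≡

  -- σ is ρS π, abstracted so that ρS does not unfold.
  exc⇔weak-exc : (σ : S₃₂₁ n) → elems (Exc σ) ≐ elems (ρ𝒜 (Exc π)) →
                 (p Fin.< perm σ ⟨$⟩ʳ p) ⇔ (q Fin.≤ f q)
  exc⇔weak-exc σ (σ⊆ρπ , ρπ⊆σ) = mk⇔ to from
    where
    to : p Fin.< perm σ ⟨$⟩ʳ p → q Fin.≤ f q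
    to p<σp = ρ𝒜-lo⇒weak-exc (excInterval σ p p<σp) (σ⊆ρπ (p , p<σp , refl , refl)) refl

    from : q Fin.≤ f q → p Fin.< perm σ ⟨$⟩ʳ p
    from q≤fq with x , x∈ , lox≡ ← weak-exc⇒ρ𝒜-lo q≤fq
              with r , r<σr , lox≡′ , _ ← ρπ⊆σ x∈
              with refl ← toℕ-injective {i = r} {p} (suc-injective (trans (sym lox≡′) lox≡))
              = r<σr

-- Counting fixed points, excedances and weak excedances

exc? : (π : S₃₂₁ n) → Decidable (λ i → i Fin.< perm π ⟨$⟩ʳ i)
exc? π i = i Finₚ.<? perm π ⟨$⟩ʳ i

wexc? : (π : S₃₂₁ n) → Decidable (λ i → i Fin.≤ perm π ⟨$⟩ʳ i)
wexc? π i = i Finₚ.≤? perm π ⟨$⟩ʳ i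

exc wexc : S₃₂₁ n → ℕ
exc  π = count (exc? π)
wexc π = count (wexc? π)

exc-cong : (π σ : S₃₂₁ n) → π ≈ₛ σ → exc π ≡ exc σ
exc-cong π σ π≈σ = sum-cong-≗ λ i → cong (λ j → 𝟙 (i Finₚ.<? j)) (π≈σ i)

fp+exc≡wexc : (π : S₃₂₁ n) → fp π + exc π ≡ wexc π
fp+exc≡wexc {n} π = begin
  fp π + exc π                         ≡⟨ cong (_+ exc π) (length-filter-tabulate fp? (λ i → i)) ⟩
  count fp? + count (exc? π)           ≡⟨ ∑-distrib-+ (𝟙 ∘ fp?) (𝟙 ∘ exc? π) ⟨
  ∑ (λ i → 𝟙 (fp? i) + 𝟙 (exc? π i))   ≡⟨ sum-cong-≗ split ⟩
  wexc π                               ∎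
  where
  open ≡-Reasoning

  fp? : Decidable (λ i → perm π ⟨$⟩ʳ i ≡ i)
  fp? i = perm π ⟨$⟩ʳ i Finₚ.≟ i

  𝟙-yes : {P : Set} (P? : Dec P) → P → 𝟙 P? ≡ 1
  𝟙-yes P? p = cong (if_then 1 else 0) (dec-true P? p)

  𝟙-no : {P : Set} (P? : Dec P) → ¬ P → 𝟙 P? ≡ 0
  𝟙-no P? ¬p = cong (if_then 1 else 0) (dec-false P? ¬p)

  split : ∀ i → 𝟙 (fp? i) + 𝟙 (exc? π i) ≡ 𝟙 (wexc? π i)
  split i with Finₚ.<-cmp i (perm π ⟨$⟩ʳ i)
  ... | tri< i<πi i≢πi _ = trans
    (cong₂ _+_ (𝟙-no (fp? i) (i≢πi ∘ sym)) (𝟙-yes (exc? π i) i<πi))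
    (sym (𝟙-yes (wexc? π i) (<⇒≤ i<πi)))
  ... | tri≈ i≮πi i≡πi _ = trans
    (cong₂ _+_ (𝟙-yes (fp? i) (sym i≡πi)) (𝟙-no (exc? π i) i≮πi))
    (sym (𝟙-yes (wexc? π i) (≤-reflexive (cong toℕ i≡πi))))
  ... | tri> i≮πi i≢πi πi<i = trans
    (cong₂ _+_ (𝟙-no (fp? i) (i≢πi ∘ sym)) (𝟙-no (exc? π i) i≮πi))
    (sym (𝟙-no (wexc? π i) (<⇒≱ πi<i)))

wexc≡1+exc : ∀ {m} (π σ : S₃₂₁ (suc m)) → elems (Exc σ) ≐ elems (ρ𝒜 (Exc π)) →
             wexc π ≡ suc (exc σ)
-- Position 0 is split off by computation: its weak-excedance indicator reduces to 1.
wexc≡1+exc {m} π σ σ≐ρπ = cong suc (begin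
  count (wexc? π ∘ suc)
    ≡⟨ sum-cong-≗ (λ j → 𝟙-⇔ (exc⇔weak-exc π (cong suc (sym (toℕ-inject₁ j))) σ σ≐ρπ)
                            (exc? σ (inject₁ j)) (wexc? π (suc j))) ⟨
  count (exc? σ ∘ inject₁)
    ≡⟨ +-identityʳ _ ⟨
  count (exc? σ ∘ inject₁) + 0
    -- The last position contributes 0 to `exc σ`, so its term can be adjoined to complete the sum.
    ≡⟨ cong (λ b → count (exc? σ ∘ inject₁) + (if b then 1 else 0))
            (dec-false (exc? σ (fromℕ m)) last≮) ⟨
  count (exc? σ ∘ inject₁) + 𝟙 (exc? σ (fromℕ m))
    ≡⟨ sum-init-last (𝟙 ∘ exc? σ) ⟨
  exc σ ∎)
  where
  open ≡-Reasoning

  last≮ : ¬ (fromℕ m Fin.< perm σ ⟨$⟩ʳ fromℕ m)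
  last≮ = ≤⇒≯ (Finₚ.≤fromℕ _)

theorem4p1 : (n : ℕ) → n ≥ 1 → Mesic (S₃₂₁-setoid n) 1ℚ ρS fp
theorem4p1 (suc m) _ = coboundary⇒1-mesic (S₃₂₁-setoid (suc m)) ρS
  ρS-cong ρS-injective fp exc exc-cong
  (λ π → trans (fp+exc≡wexc π) (wexc≡1+exc π (ρS π) (Exc-ρS π)))
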